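{- Let $H$ be a digraph (possibly with loops) and let $D$ be an $H$-colored semicomplete digraph. If $k \geq 3$, then $D$ has a $(k,H)$-kernel.
   Context: All digraphs are finite. A digraph is semicomplete if every two distinct vertices are joined by at least one arc. $D$ has no loops and comes with a map $\rho: A(D)\to V(H)$. For a walk $W=(x_0,\ldots,x_n)$ in $D$, there is an obstruction on $x_i$ if $(\rho(x_{i-1},x_i),\rho(x_i,x_{i+1})) \notin A(H)$; for an open walk this is considered at internal vertices $x_i$, $1\le i\le n-1$, for a closed walk at all $i\in\{0,\ldots,n-1\}$ with indices modulo $n$. $O_H(W)$ is the set of indices with an obstruction; the $H$-length is $l_H(W)=|O_H(W)|+1$ for open $W$ and $|O_H(W)|$ for closed $W$. A $(k,H)$-kernel ($k\ge2$) is a set $S\subseteq V(D)$ such that for every two distinct $u,v\in S$ every directed $uv$-path in $D$ has $H$-length at least $k$, and for every $x\in V(D)\setminus S$ there is a directed path from $x$ to a vertex of $S$ of $H$-length at most $k-1$. -}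

module Defs where

open import Data.Bool using (Bool; T; not)
open import Data.Fin using (Fin; zero; suc; inject₁; fromℕ)
open import Data.Fin.Subset using (Subset; _∈_; _∉_; ∣_∣)
open import Data.Nat using (ℕ; zero; suc; pred; _≤_; _≥_; _∸_)
open import Data.Product using (Σ-syntax; ∃-syntax; _×_; _,_)
open import Data.Sum using (_⊎_)
open import Data.Vec using ([]; tabulate)
open import Function.Definitions using (Injective)
open import Relation.Binary.PropositionalEquality using (_≡_; _≢_)
open import Relation.Nullary using (¬_)

-- Arcs form a set of ordered pairs: loops and pairs of opposite arcs are
-- allowed, parallel arcs are not.
record Digraph : Set where
  field
    order : ℕ
    adj   : Fin order → Fin order → Bool

  Vertex : Set
  Vertex = Fin order

  Arc : Vertex → Vertex → Set
  Arc u v = T (adj u v)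

  ArcSet : Set
  ArcSet = Σ[ u ∈ Vertex ] Σ[ v ∈ Vertex ] Arc u v

open Digraph public using (Vertex; Arc; ArcSet)

Loopless : Digraph → Set
Loopless D = ∀ (u : Vertex D) → ¬ Arc D u u

Semicomplete : Digraph → Set
Semicomplete D = ∀ (u v : Vertex D) → u ≢ v → Arc D u v ⊎ Arc D v u

record Walk (D : Digraph) (n : ℕ) : Set where
  field
    vertex : Fin (suc n) → Vertex D
    arc    : ∀ (i : Fin n) → Arc D (vertex (inject₁ i)) (vertex (suc i))

  arcAt : Fin n → ArcSet D
  arcAt i = vertex (inject₁ i) , vertex (suc i) , arc i

record Path (D : Digraph) (u v : Vertex D) : Set where
  field
    {length} : ℕ
    walk     : Walk D length

  open Walk walk public

  field
    distinct : Injective _≡_ _≡_ vertex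
    source   : vertex zero ≡ u
    target   : vertex (fromℕ length) ≡ v

module _ (H D : Digraph) (ρ : ArcSet D → Vertex H) where

  -- Obstructions of an open walk (x₀ , … , xₙ).  Only the internal vertices
  -- x₁ , … , xₙ₋₁ count; the element j of the subset stands for xⱼ₊₁, which
  -- lies between the arcs with indices j and j + 1.
  obstructions : ∀ {n} → Walk D n → Subset (pred n)
  obstructions {zero}  W = []
  obstructions {suc m} W = tabulate λ j →
    not (Digraph.adj H (ρ (Walk.arcAt W (inject₁ j))) (ρ (Walk.arcAt W (suc j))))

  -- The H-length of an open walk.  Kernels only involve paths between distinct
  -- vertices, so closed walks never arise.
  H-length : ∀ {n} → Walk D n → ℕ
  H-length W = suc ∣ obstructions W ∣

  record IsKernel (k : ℕ) (S : Subset (Digraph.order D)) : Set where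
    field
      k≥2         : k ≥ 2
      independent : ∀ {u v} → u ∈ S → v ∈ S → u ≢ v →
                    (P : Path D u v) → k ≤ H-length (Path.walk P)
      absorbent   : ∀ {x} → x ∉ S →
                    ∃[ y ] (y ∈ S × Σ[ P ∈ Path D x y ] H-length (Path.walk P) ≤ k ∸ 1)

{-# OPTIONS --safe #-}

-- Two vertices of D are joined by an arc, which has H-length 1, so a kernel is
-- a single vertex.  A path with at most two arcs has at most one internal
-- vertex, hence H-length at most 2 ≤ k − 1, so it suffices to find a vertex
-- reached from every vertex in at most two steps.
module Submission where

open import Data.Bool.Properties using (T?)
open import Data.Fin using (Fin; zero; suc; _≟_)
open import Data.Fin.Properties using (any?)
open import Data.Fin.Subset using (⊥; ⁅_⁆)
open import Data.Fin.Subset.Properties using (∉⊥; x∈⁅x⁆; x∈⁅y⁆⇒x≡y; ∣p∣≤n)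
open import Data.Nat using (ℕ; zero; suc; pred; _≤_; _≥_; s≤s)
open import Data.Nat.Properties using (≤-trans; n≤1+n; ∸-monoˡ-≤)
open import Data.Product using (∃-syntax; Σ-syntax; _×_; _,_)
open import Data.Sum using (_⊎_; inj₁; inj₂)
open import Function.Base using (id; _∘_)
open import Relation.Binary.PropositionalEquality using (_≡_; _≢_; refl; sym; trans)
open import Relation.Nullary using (¬_; Dec; yes; no; contradiction)
open import Relation.Nullary.Decidable using (_×-dec_; _⊎-dec_; map′)
open import Defs

-- Walks rather than paths: `two` allows `x` and `y` to coincide, so walks can be rerouted without
-- checking distinctness. Genuine paths are recovered once the ends are known to differ.
data Within2 (D : Digraph) (x y : Vertex D) : Set where
  here : x ≡ y → Within2 D x y
  one  : Arc D x y → Within2 D x y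
  two  : ∀ {z} → Arc D x z → Arc D z y → Within2 D x y

module _ (D : Digraph) where

  open Digraph D using (adj)

  within2? : ∀ x y → Dec (Within2 D x y)
  within2? x y = map′ to from
    ((x ≟ y) ⊎-dec T? (adj x y) ⊎-dec any? λ z → T? (adj x z) ×-dec T? (adj z y))
    where
    to : x ≡ y ⊎ Arc D x y ⊎ ∃[ z ] (Arc D x z × Arc D z y) → Within2 D x y
    to (inj₁ e)                  = here e
    to (inj₂ (inj₁ a))           = one a
    to (inj₂ (inj₂ (_ , a , b))) = two a b

    from : Within2 D x y → x ≡ y ⊎ Arc D x y ⊎ ∃[ z ] (Arc D x z × Arc D z y)
    from (here e)  = inj₁ e
    from (one a)   = inj₂ (inj₁ a)
    from (two a b) = inj₂ (inj₂ (_ , a , b))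

  module _ (semi : Semicomplete D) where

    -- If x does not reach a in two steps, then a and all in-neighbours of a
    -- send an arc to x.
    within2-transfer : ∀ {a x} → ¬ Within2 D x a → ∀ {c} → Within2 D c a → Within2 D c x
    within2-transfer {a} {x} x↛a = λ where
        (here refl)   → one a⟶x
        (one c⟶a)     → one (in-neighbour c⟶a)
        (two c⟶z z⟶a) → two c⟶z (in-neighbour z⟶a)
      where
      a⟶x : Arc D a x
      a⟶x with semi a x (x↛a ∘ here ∘ sym)
      ... | inj₁ a⟶x = a⟶x
      ... | inj₂ x⟶a = contradiction (one x⟶a) x↛a

      in-neighbour : ∀ {z} → Arc D z a → Arc D z x
      in-neighbour {z} z⟶a with semi z x (λ { refl → x↛a (one z⟶a) })
      ... | inj₁ z⟶x = z⟶x
      ... | inj₂ x⟶z = contradiction (two x⟶z z⟶a) x↛a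

    -- Induction on the size of the family, with a current candidate `a` that is kept or replaced as
    -- each vertex is added. Walks live in all of `D`, and their middle vertices may lie outside the
    -- family, so no induced subdigraph is formed.
    family-king : ∀ n (f : Fin (suc n) → Vertex D) → ∃[ a ] (∀ i → Within2 D (f i) a)
    family-king zero    f = f zero , λ { zero → here refl }
    family-king (suc n) f with family-king n (f ∘ suc)
    ... | a , reach with within2? (f zero) a
    ...   | yes p = a , λ { zero → p ; (suc i) → reach i }
    -- The vertex that fails to reach `a` takes its place: whatever reached `a` in two steps now
    -- reaches it.
    ...   | no ¬p = f zero , λ { zero    → here refl
                               ; (suc i) → within2-transfer ¬p (reach i) }

  arc-path : Loopless D → ∀ {x y} → Arc D x y → Path D x y
  arc-path loopless {x} {y} x⟶y = record
    { walk     = record { vertex = vertex ; arc = λ { zero → x⟶y } }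
    ; distinct = distinct _ _
    ; source   = refl
    ; target   = refl
    }
    where
    vertex : Fin 2 → Vertex D
    vertex zero       = x
    vertex (suc zero) = y

    x≢y : x ≢ y
    x≢y refl = loopless x x⟶y

    distinct : ∀ i j → vertex i ≡ vertex j → i ≡ j
    distinct zero       zero       _ = refl
    distinct zero       (suc zero) e = contradiction e x≢y
    distinct (suc zero) zero       e = contradiction (sym e) x≢y
    distinct (suc zero) (suc zero) _ = refl

  -- Looplessness separates the middle vertex from both ends; only the ends must be assumed
  -- distinct.
  two-arc-path : Loopless D → ∀ {x z y} → x ≢ y → Arc D x z → Arc D z y → Path D x y
  two-arc-path loopless {x} {z} {y} x≢y x⟶z z⟶y = record
    { walk     = record { vertex = vertex ; arc = λ { zero → x⟶z ; (suc zero) → z⟶y } }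
    ; distinct = distinct _ _
    ; source   = refl
    ; target   = refl
    }
    where
    vertex : Fin 3 → Vertex D
    vertex zero             = x
    vertex (suc zero)       = z
    vertex (suc (suc zero)) = y

    x≢z : x ≢ z
    x≢z refl = loopless x x⟶z

    z≢y : z ≢ y
    z≢y refl = loopless z z⟶y

    distinct : ∀ i j → vertex i ≡ vertex j → i ≡ j
    distinct zero             zero             _ = refl
    distinct zero             (suc zero)       e = contradiction e x≢z
    distinct zero             (suc (suc zero)) e = contradiction e x≢y
    distinct (suc zero)       zero             e = contradiction (sym e) x≢z
    distinct (suc zero)       (suc zero)       _ = refl
    distinct (suc zero)       (suc (suc zero)) e = contradiction e z≢y
    distinct (suc (suc zero)) zero             e = contradiction (sym e) x≢y
    distinct (suc (suc zero)) (suc zero)       e = contradiction (sym e) z≢y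
    distinct (suc (suc zero)) (suc (suc zero)) _ = refl

module _ (H D : Digraph) (ρ : ArcSet D → Vertex H) where

  -- Each internal vertex carries at most one obstruction, whatever the colours.
  H-length≤ : ∀ {n} (W : Walk D n) → H-length H D ρ W ≤ suc (pred n)
  H-length≤ W = s≤s (∣p∣≤n (obstructions H D ρ W))

  within2⇒path : Loopless D → ∀ {x y} → x ≢ y → Within2 D x y →
                 Σ[ P ∈ Path D x y ] H-length H D ρ (Path.walk P) ≤ 2
  within2⇒path loopless x≢y (here x≡y) = contradiction x≡y x≢y
  within2⇒path loopless x≢y (one a)    = P , ≤-trans (H-length≤ (Path.walk P)) (n≤1+n 1)
    where P = arc-path D loopless a
  within2⇒path loopless x≢y (two a b)  = P , H-length≤ (Path.walk P)
    where P = two-arc-path D loopless x≢y a b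

  singleton-kernel : Loopless D → ∀ {k} → k ≥ 3 → ∀ {a} →
                     (∀ x → Within2 D x a) → IsKernel H D ρ k ⁅ a ⁆
  singleton-kernel loopless k≥3 {a} reach = record
    { k≥2         = ≤-trans (n≤1+n 2) k≥3
    ; independent = λ u∈ v∈ u≢v _ →
        contradiction (trans (x∈⁅y⁆⇒x≡y a u∈) (sym (x∈⁅y⁆⇒x≡y a v∈))) u≢v
    ; absorbent   = λ {x} x∉ →
        let P , short = within2⇒path loopless (λ { refl → x∉ (x∈⁅x⁆ a) }) (reach x)
        -- The bound `k ≥ 3` enters here, as `2 ≤ k ∸ 1`.
        in a , x∈⁅x⁆ a , P , ≤-trans short (∸-monoˡ-≤ 1 k≥3)
    }

theorem6 : (H D : Digraph) (ρ : ArcSet D → Vertex H) → Loopless D → Semicomplete D →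
    (k : ℕ) → k ≥ 3 → ∃[ S ] IsKernel H D ρ k S
-- `family-king` needs a nonempty family, so the digraph without vertices is treated apart, with the
-- empty kernel.
theorem6 H D@(record { order = zero }) ρ loopless semi k k≥3 = ⊥ , record
  { k≥2         = ≤-trans (n≤1+n 2) k≥3
  ; independent = λ u∈ → contradiction u∈ ∉⊥
  ; absorbent   = λ { {()} }
  }
theorem6 H D@(record { order = suc n }) ρ loopless semi k k≥3 =
  -- The family `id` lists every vertex of `D`.
  let a , reach = family-king D semi n id
  in ⁅ a ⁆ , singleton-kernel H D ρ loopless k≥3 reach
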